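{- Let $q\geq 3$ be a prime power and let $(\mathcal{P},\mathcal{G},\mathcal{B})$ be a resolvable transversal design $\mathrm{TD}(q-1,q)$ with groups $G_1,\dots,G_{q-1}$, and label the points of each group as $G_i=\{p_{i,1},\dots,p_{i,q}\}$. Let $\mathcal{C}_2(q)$ be the combinatorial batch code whose servers are the $q(q-1)$ points in $\mathcal{P}$ and whose items are the $q^2$ blocks in $\mathcal{B}$ together with the $q-3$ sets $\{p_{i,2},p_{i,3},\dots,p_{i,q}\}$, $1\leq i\leq q-3$, where an item is stored in exactly those servers that are the points it contains. Then $\mathcal{C}_2(q)$ is a $(q-1)$-uniform $(q^2+q-3,\; (q-1)(q^2+q-3),\; q^2-q-1,\; q^2-q)$-CBC, and the difference between the upper bound $$n(m,c,k)\leq \left\lfloor\frac{(k-1)\binom{m}{c}}{\binom{k-1}{c}}\right\rfloor$$ and the number of items of $\mathcal{C}_2(q)$ is $1$; that is, with $m=q^2-q$, $k=q^2-q-1$, $c=q-1$, $$\left\lfloor\frac{(k-1)\binom{m}{c}}{\binom{k-1}{c}}\right\rfloor-(q^2+q-3)=1.$$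
   Context: An $(n,N,k,m)$-CBC (combinatorial batch code) consists of a set $\mathcal{S}$ of $m$ servers and $n$ items $x_1,\dots,x_n$, where item $x_j$ is stored in the servers of a subset $X_j\subseteq\mathcal{S}$, with total storage $\sum_{j=1}^n|X_j|=N$, such that any $k$ items can be retrieved by reading at most one item from each server; that is, for any $k$ distinct indices $i_1,\dots,i_k$ there exist pairwise distinct servers $s_1,\dots,s_k$ with $s_j\in X_{i_j}$ for all $j$. It is $c$-uniform if $|X_j|=c$ for every $j$ (so $N=cn$). $n(m,c,k)$ denotes the maximum $n$ for which a $c$-uniform $(n,cn,k,m)$-CBC exists; the displayed upper bound on it is a known result from earlier literature. A transversal design $\mathrm{TD}(\ell,h)$ is a triple $(\mathcal{P},\mathcal{G},\mathcal{B})$ where $\mathcal{P}$ is a set of $\ell h$ points; $\mathcal{G}$ is a partition of $\mathcal{P}$ into $\ell$ sets (groups), each of size $h$; $\mathcal{B}$ is a collection of $\ell$-subsets of $\mathcal{P}$ (blocks); each block meets each group in exactly one point; and any pair of points from different groups is contained in exactly one block. It is resolvable if $\mathcal{B}$ can be partitioned into $h$ sets (parallel classes), each containing $h$ blocks, such that each point is contained in exactly one block of each parallel class. -}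

module Defs where

open import Data.Nat using (ℕ; zero; suc; _+_; _*_; _∸_; _^_; _/_; _≤_; _<_; z≤n; s≤s; NonZero; >-nonZero)
open import Data.Nat.Properties
open import Data.Nat.Combinatorics using (_C_; nCk+nC[k+1]≡[n+1]C[k+1])
open import Data.Nat.ListAction using (sum)
open import Data.Nat.Primality using (Prime)
open import Data.Fin using (Fin; inject≤; splitAt)
open import Data.Fin.Subset using (Subset; _∈_; ∣_∣; ⁅_⁆; ⋃)
open import Data.List using (List; map; drop; tabulate)
open import Data.Product using (Σ; Σ-syntax; ∃-syntax; ∃!; _×_; _,_)
open import Data.Sum using ([_,_]′)
open import Function using (_∘_; _⇔_)
open import Function.Definitions using (Injective)
open import Relation.Binary.PropositionalEquality using (_≡_; _≢_; cong; subst; sym)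

PrimePower : ℕ → Set
PrimePower q = ∃[ p ] ∃[ e ] (Prime p × 1 ≤ e × q ≡ p ^ e)

record BatchCode : Set where
  field
    servers : ℕ
    items   : ℕ
    store   : Fin items → Subset servers

  totalStorage : ℕ
  totalStorage = sum (tabulate (λ j → ∣ store j ∣))

open BatchCode

Uniform : ℕ → BatchCode → Set
Uniform c 𝒞 = ∀ j → ∣ store 𝒞 j ∣ ≡ c

record IsCBC (n N k m : ℕ) (𝒞 : BatchCode) : Set where
  field
    items≡       : items 𝒞 ≡ n
    storage≡     : totalStorage 𝒞 ≡ N
    servers≡     : servers 𝒞 ≡ m
    retrievable  : (i : Fin k → Fin (items 𝒞)) → Injective _≡_ _≡_ i →
                   Σ[ s ∈ (Fin k → Fin (servers 𝒞)) ]
                     (Injective _≡_ _≡_ s × (∀ j → s j ∈ store 𝒞 (i j)))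

-- Blocks are an indexed family, so for ℓ ≤ 1 they may repeat (as they must in
-- a resolvable TD(1,h) with h ≥ 2); for ℓ ≥ 2 and h ≥ 1 the field
-- `cross-pair` forces the family to be injective.
record TransversalDesign (ℓ h : ℕ) : Set where
  field
    group           : Fin ℓ → Subset (ℓ * h)
    group-size      : ∀ i → ∣ group i ∣ ≡ h
    group-partition : ∀ x → ∃! _≡_ (λ i → x ∈ group i)
    blocks          : ℕ
    block           : Fin blocks → Subset (ℓ * h)
    block-size      : ∀ β → ∣ block β ∣ ≡ ℓ
    block-meets     : ∀ β i → ∃! _≡_ (λ x → x ∈ block β × x ∈ group i)
    cross-pair      : ∀ {i i′} → i ≢ i′ → ∀ {x y} → x ∈ group i → y ∈ group i′ →
                      ∃! _≡_ (λ β → x ∈ block β × y ∈ block β)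

open TransversalDesign

record Resolution {ℓ h : ℕ} (D : TransversalDesign ℓ h) : Set where
  field
    parallelClass   : Fin h → Subset (blocks D)
    class-partition : ∀ β → ∃! _≡_ (λ r → β ∈ parallelClass r)
    class-size      : ∀ r → ∣ parallelClass r ∣ ≡ h
    class-covers    : ∀ r x → ∃! _≡_ (λ β → β ∈ parallelClass r × x ∈ block D β)

record Labelling {ℓ h : ℕ} (D : TransversalDesign ℓ h) : Set where
  field
    point           : Fin ℓ → Fin h → Fin (ℓ * h)
    point-injective : ∀ i → Injective _≡_ _≡_ (point i)
    group-points    : ∀ i x → x ∈ group D i ⇔ (∃[ j ] x ≡ point i j)

open Labelling

-- {p_{i,2}, …, p_{i,h}}: the label p_{i,1} is `point i zero`, the entry dropped.
punctured : ∀ {ℓ h} {D : TransversalDesign ℓ h} → Labelling D → Fin ℓ → Subset (ℓ * h)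
punctured p i = ⋃ (map ⁅_⁆ (drop 1 (tabulate (point p i))))

C₂ : ∀ q (D : TransversalDesign (q ∸ 1) q) → Labelling D → BatchCode
C₂ q D p = record
  { servers = (q ∸ 1) * q
  ; items   = blocks D + (q ∸ 3)
  ; store   = [ block D , (λ i → punctured p (inject≤ i (∸-monoʳ-≤ q (s≤s z≤n)))) ]′ ∘ splitAt (blocks D)
  }

nCk-nonZero : ∀ {n k} → k ≤ n → NonZero (n C k)
nCk-nonZero = >-nonZero ∘ positive
  where
  positive : ∀ {n k} → k ≤ n → 0 < n C k
  positive z≤n = s≤s z≤n
  positive {suc n} {suc k} (s≤s k≤n) =
    subst (0 <_) (nCk+nC[k+1]≡[n+1]C[k+1] n k) (≤-trans (positive k≤n) (m≤m+n _ _))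

-- ⌊ (k − 1) · binom(m, c) / binom(k − 1, c) ⌋; c < k makes the divisor nonzero.
upperBound : (m c k : ℕ) → .(c < k) → ℕ
upperBound m c k c<k = ((k ∸ 1) * (m C c) / ((k ∸ 1) C c)) {{nCk-nonZero (∸-monoˡ-≤ 1 c<k)}}

C₂-bound-defined : ∀ {q} → 3 ≤ q → q ∸ 1 < q ^ 2 ∸ q ∸ 1
C₂-bound-defined {q@(suc q-1)} 3≤q = m+n≤o⇒m≤o∸n q (m+n≤o⇒m≤o∸n (q + 1) (begin
  q + 1 + q     ≤⟨ +-monoˡ-≤ q (+-monoʳ-≤ q (s≤s z≤n)) ⟩
  q + q + q     ≡⟨ +-assoc q q q ⟩
  q + (q + q)   ≡⟨ cong (λ t → q + (q + t)) (sym (+-identityʳ q)) ⟩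
  3 * q         ≤⟨ *-monoˡ-≤ q 3≤q ⟩
  q * q         ≡⟨ cong (q *_) (sym (*-identityʳ q)) ⟩
  q ^ 2         ∎))
  where open ≤-Reasoning

{-# OPTIONS --safe #-}
-- By Hall's theorem it suffices that, among any k = q² − q − 1 items, at most ∣U∣ are stored
-- inside U, for every set U of servers.  Let t be the number of servers outside U.  Since k is one
-- less than the number of servers, only t ≥ 2 matters, and all items may then be counted.  Each
-- point lies in q blocks and two points in at most one, so by Bonferroni at most
-- q² − sq + s(s − 1)/2 blocks avoid s given points outside U; with s = 2, 3, 4 this settles t = 2,
-- 3 ≤ t ≤ q and q < t ≤ 2q − 3.  For t ≥ 2q − 2 we have ∣U∣ ≤ (q − 1)(q − 2), so no point of U can
-- have q − 1 blocks inside U; double counting bounds the blocks inside U by ∣U∣(q − 2)/(q − 1), and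
-- the punctured groups inside U are disjoint, hence at most ∣U∣/(q − 1) in number.
module Submission where

open import Data.Nat using (ℕ; zero; suc; NonZero; _!; _+_; _*_; _∸_; _^_; _≤_; _<_; z≤n; s≤s)
open import Data.Nat.Properties hiding (suc-injective)
open import Data.Fin using (Fin; zero; suc; splitAt; inject≤)
open import Data.Fin.Properties using (suc-injective; any?; all?; inject≤-injective)
  renaming (_≟_ to _≟ᶠ_)
open import Data.Fin.Subset
  using (Subset; inside; outside; _∈_; _∉_; _⊆_; _∩_; _∪_; ∁; ⁅_⁆; ⋃; ⊥; ∣_∣)
open import Data.Fin.Subset.Properties
open import Data.Product using (Σ-syntax; ∃; ∃-syntax; ∃!; _×_; _,_; proj₁; proj₂)
open import Data.Sum using (_⊎_; inj₁; inj₂; [_,_]′)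
open import Data.Unit using (tt)
open import Data.List using (map; tabulate)
open import Data.Nat.ListAction using () renaming (sum to sumˡ)
open import Data.Nat.Combinatorics using (_C_; nCk≡n!/k![n-k]!; k![n∸k]!∣n!)
open import Data.Nat.DivMod using (_/_; m/n*n≡m; m*n/n≡m; /-monoˡ-≤; m<n*o⇒m/o<n)
open import Data.Vec using ([]; _∷_)
open import Function using (_∘_; id; Equivalence)
open import Function.Definitions using (Injective)
open import Relation.Binary.PropositionalEquality
open import Relation.Nullary using (¬_; Dec; yes; no; contradiction; _×-dec_; ¬?)
open import Relation.Nullary.Decidable using (decidable-stable)
open import Relation.Unary using (Pred; Decidable)
open import Algebra.Properties.Semiring.Sum +-*-semiring
open import Data.Nat.Tactic.RingSolver using (solve-∀)
open import Defs

private variable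
  k m n : ℕ
  P Q : Set

-- Sums and counting

𝟙 : Dec P → ℕ
𝟙 (yes _) = 1
𝟙 (no  _) = 0

𝟙-yes : (P? : Dec P) → P → 𝟙 P? ≡ 1
𝟙-yes (yes _) _ = refl
𝟙-yes (no ¬p) p = contradiction p ¬p

𝟙-no : (P? : Dec P) → ¬ P → 𝟙 P? ≡ 0
𝟙-no (yes p) ¬p = contradiction p ¬p
𝟙-no (no _)  _  = refl

𝟙-mono : (P? : Dec P) (Q? : Dec Q) → (P → Q) → 𝟙 P? ≤ 𝟙 Q?
𝟙-mono (yes p) Q? f = ≤-reflexive (sym (𝟙-yes Q? (f p)))
𝟙-mono (no _)  Q? f = z≤n

𝟙-× : (P? : Dec P) (Q? : Dec Q) → 𝟙 (P? ×-dec Q?) ≡ 𝟙 P? * 𝟙 Q?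
𝟙-× (yes _) (yes _) = refl
𝟙-× (yes _) (no _)  = refl
𝟙-× (no _)  _       = refl

sum-mono : {f g : Fin n → ℕ} → (∀ i → f i ≤ g i) → sum f ≤ sum g
sum-mono {zero}  f≤g = z≤n
sum-mono {suc n} f≤g = +-mono-≤ (f≤g zero) (sum-mono (f≤g ∘ suc))

sum-const : ∀ n {c} → ∑[ i < n ] c ≡ n * c
sum-const zero    = refl
sum-const (suc n) = cong (_ +_) (sum-const n)

term≤sum : (f : Fin n → ℕ) (i : Fin n) → f i ≤ sum f
term≤sum f zero    = m≤m+n _ _
term≤sum f (suc i) = ≤-trans (term≤sum (f ∘ suc) i) (m≤n+m _ _)

sum-++ : ∀ m {n} (f : Fin m ⊎ Fin n → ℕ) →
         ∑[ i < m + n ] f (splitAt m i) ≡ ∑[ i < m ] f (inj₁ i) + ∑[ j < n ] f (inj₂ j)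
sum-++ zero    f = refl
sum-++ (suc m) {n} f = trans
  (cong (f (inj₁ zero) +_) (trans (sum-cong-≗ split) (sum-++ m f′)))
  (sym (+-assoc (f (inj₁ zero)) _ _))
  where
  f′ : Fin m ⊎ Fin n → ℕ
  f′ = [ f ∘ inj₁ ∘ suc , f ∘ inj₂ ]′

  split : ∀ i → f (splitAt (suc m) (suc i)) ≡ f′ (splitAt m i)
  split i with splitAt m i
  ... | inj₁ _ = refl
  ... | inj₂ _ = refl

-- This bounds the inner sum of a double count once the order of summation has been exchanged: one
-- witness for `P` excludes all others.
count≤𝟙 : {P : Pred (Fin n) _} (P? : Decidable P) (Q? : Dec Q) →
          (∀ {i j} → P i → P j → i ≡ j) → (∀ {i} → P i → Q) →
          ∑[ i < n ] 𝟙 (P? i) ≤ 𝟙 Q?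
count≤𝟙 {zero}  P? Q? unique P⇒Q = z≤n
count≤𝟙 {suc n} P? Q? unique P⇒Q with P? zero
... | no _   = count≤𝟙 (P? ∘ suc) Q? (λ p p′ → suc-injective (unique p p′)) P⇒Q
... | yes p₀ = begin
  1 + ∑[ i < n ] 𝟙 (P? (suc i))
    ≡⟨ cong suc (trans (sum-cong-≗ (λ i → 𝟙-no (P? (suc i)) (λ p → contradiction (unique p₀ p) λ ())))
                       (sum-replicate-zero n)) ⟩
  1
    ≡⟨ 𝟙-yes Q? (P⇒Q p₀) ⟨
  𝟙 Q? ∎
  where open ≤-Reasoning

count-∃! : {P : Pred (Fin n) _} (P? : Decidable P) (Q? : Dec Q) →
           (Q → ∃! _≡_ P) → (∀ {i} → P i → Q) → ∑[ i < n ] 𝟙 (P? i) ≡ 𝟙 Q?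
count-∃! P? (no ¬q) _ P⇒Q = n≤0⇒n≡0 (count≤𝟙 P? (no ¬q) (λ p → contradiction (P⇒Q p) ¬q) P⇒Q)
count-∃! P? (yes q) ∃!P P⇒Q with ∃!P q
... | i , p , unique = ≤-antisym
  (count≤𝟙 P? (yes q) (λ p p′ → trans (sym (unique p)) (unique p′)) P⇒Q)
  (≤-trans (≤-reflexive (sym (𝟙-yes (P? i) p))) (term≤sum (𝟙 ∘ P?) i))

-- Each `f (i j)` is spread over all `y` by a Kronecker delta; after exchanging the sums, every `y`
-- has at most one preimage. This allows a selection of items to be replaced by all of them.
sum-injective-≤ : (f : Fin n → ℕ) (i : Fin k → Fin n) → Injective _≡_ _≡_ i → sum (f ∘ i) ≤ sum f
sum-injective-≤ {n} {k} f i i-inj = begin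
  ∑[ j < k ] f (i j)
    ≡⟨ sum-cong-≗ select ⟩
  ∑[ j < k ] ∑[ y < n ] (𝟙 (i j ≟ᶠ y) * f y)
    ≡⟨ ∑-comm (λ j y → 𝟙 (i j ≟ᶠ y) * f y) ⟩
  ∑[ y < n ] ∑[ j < k ] (𝟙 (i j ≟ᶠ y) * f y)
    ≤⟨ sum-mono fibre ⟩
  sum f ∎
  where
  open ≤-Reasoning
  select : ∀ j → f (i j) ≡ ∑[ y < n ] (𝟙 (i j ≟ᶠ y) * f y)
  select j = begin-equality
    f (i j)
      ≡⟨ *-identityˡ _ ⟨
    1 * f (i j)
      ≡⟨ cong (_* f (i j)) (count-∃! (i j ≟ᶠ_) (yes tt) (λ _ → i j , refl , id) (λ _ → tt)) ⟨
    (∑[ y < n ] 𝟙 (i j ≟ᶠ y)) * f (i j)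
      ≡⟨ *-distribʳ-sum (f (i j)) (λ y → 𝟙 (i j ≟ᶠ y)) ⟩
    ∑[ y < n ] (𝟙 (i j ≟ᶠ y) * f (i j))
      ≡⟨ sum-cong-≗ at ⟩
    ∑[ y < n ] (𝟙 (i j ≟ᶠ y) * f y) ∎
    where
    at : ∀ y → 𝟙 (i j ≟ᶠ y) * f (i j) ≡ 𝟙 (i j ≟ᶠ y) * f y
    at y with i j ≟ᶠ y
    ... | yes refl = refl
    ... | no _     = refl
  fibre : ∀ y → ∑[ j < k ] (𝟙 (i j ≟ᶠ y) * f y) ≤ f y
  fibre y = begin
    ∑[ j < k ] (𝟙 (i j ≟ᶠ y) * f y)
      ≡⟨ *-distribʳ-sum (f y) (λ j → 𝟙 (i j ≟ᶠ y)) ⟨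
    (∑[ j < k ] 𝟙 (i j ≟ᶠ y)) * f y
      ≤⟨ *-monoˡ-≤ (f y) (count≤𝟙 (λ j → i j ≟ᶠ y) (yes tt)
                            (λ e e′ → i-inj (trans e (sym e′))) (λ _ → tt)) ⟩
    1 * f y
      ≡⟨ *-identityˡ _ ⟩
    f y ∎

𝟙-there : ∀ {s} (p : Subset n) x → 𝟙 (x ∈? p) ≡ 𝟙 (suc x ∈? (s ∷ p))
𝟙-there p x with x ∈? p
... | yes _ = refl
... | no _  = refl

∣p∣≡sum : (p : Subset n) → ∣ p ∣ ≡ ∑[ x < n ] 𝟙 (x ∈? p)
∣p∣≡sum []            = refl
∣p∣≡sum (outside ∷ p) = trans (∣p∣≡sum p) (sum-cong-≗ (𝟙-there p))
∣p∣≡sum (inside ∷ p)  = cong suc (trans (∣p∣≡sum p) (sum-cong-≗ (𝟙-there p)))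

count-×∈ : (P? : Dec P) (p : Subset n) → ∑[ x < n ] 𝟙 (P? ×-dec x ∈? p) ≡ 𝟙 P? * ∣ p ∣
count-×∈ {n = n} P? p = begin
  ∑[ x < n ] 𝟙 (P? ×-dec x ∈? p)      ≡⟨ sum-cong-≗ (λ x → 𝟙-× P? (x ∈? p)) ⟩
  ∑[ x < n ] (𝟙 P? * 𝟙 (x ∈? p))      ≡⟨ *-distribˡ-sum (𝟙 P?) (λ x → 𝟙 (x ∈? p)) ⟨
  𝟙 P? * (∑[ x < n ] 𝟙 (x ∈? p))      ≡⟨ cong (𝟙 P? *_) (∣p∣≡sum p) ⟨
  𝟙 P? * ∣ p ∣                        ∎
  where open ≡-Reasoning

∣p∪q∣+∣p∩q∣ : (p q : Subset n) → ∣ p ∪ q ∣ + ∣ p ∩ q ∣ ≡ ∣ p ∣ + ∣ q ∣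
∣p∪q∣+∣p∩q∣ []            []            = refl
∣p∪q∣+∣p∩q∣ (outside ∷ p) (outside ∷ q) = ∣p∪q∣+∣p∩q∣ p q
∣p∪q∣+∣p∩q∣ (outside ∷ p) (inside  ∷ q) = trans (cong suc (∣p∪q∣+∣p∩q∣ p q)) (sym (+-suc _ _))
∣p∪q∣+∣p∩q∣ (inside  ∷ p) (outside ∷ q) = cong suc (∣p∪q∣+∣p∩q∣ p q)
∣p∪q∣+∣p∩q∣ (inside  ∷ p) (inside  ∷ q) =
  cong suc (trans (+-suc _ _) (trans (cong suc (∣p∪q∣+∣p∩q∣ p q)) (sym (+-suc _ _))))

∣⁅x⁆∪p∣ : ∀ {x} (p : Subset n) → x ∉ p → ∣ ⁅ x ⁆ ∪ p ∣ ≡ suc ∣ p ∣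
∣⁅x⁆∪p∣ {n} {x} p x∉p = begin
  ∣ ⁅ x ⁆ ∪ p ∣                     ≡⟨ +-identityʳ _ ⟨
  ∣ ⁅ x ⁆ ∪ p ∣ + 0                 ≡⟨ cong (∣ ⁅ x ⁆ ∪ p ∣ +_) (∣⊥∣≡0 n) ⟨
  ∣ ⁅ x ⁆ ∪ p ∣ + ∣ ⊥ {n} ∣         ≡⟨ cong (λ r → ∣ ⁅ x ⁆ ∪ p ∣ + ∣ r ∣) (Empty-unique empty) ⟨
  ∣ ⁅ x ⁆ ∪ p ∣ + ∣ ⁅ x ⁆ ∩ p ∣     ≡⟨ ∣p∪q∣+∣p∩q∣ ⁅ x ⁆ p ⟩
  ∣ ⁅ x ⁆ ∣ + ∣ p ∣                 ≡⟨ cong (_+ ∣ p ∣) (∣⁅x⁆∣≡1 x) ⟩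
  suc ∣ p ∣                         ∎
  where
  open ≡-Reasoning
  empty : ¬ ∃ (_∈ ⁅ x ⁆ ∩ p)
  empty (y , y∈) with x∈p∩q⁻ ⁅ x ⁆ p y∈
  ... | y∈⁅x⁆ , y∈p = x∉p (subst (_∈ p) (x∈⁅y⁆⇒x≡y x y∈⁅x⁆) y∈p)

-- Hall's theorem

tally : (Fin k → Subset m) → Subset m → ℕ
tally {k} A U = ∑[ j < k ] 𝟙 (A j ⊆? U)

-- Hall's condition indexed by sets of servers instead of subfamilies; the usual form for a
-- subfamily follows by taking its union as `U`.
HallCondition : (Fin k → Subset m) → Set
HallCondition A = ∀ U → tally A U ≤ ∣ U ∣

tally-mono : (A B : Fin k → Subset m) (U V : Subset m) →
             (∀ j → A j ⊆ U → B j ⊆ V) → tally A U ≤ tally B V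
tally-mono A B U V f = sum-mono (λ j → 𝟙-mono (A j ⊆? U) (B j ⊆? V) (f j))

-- A set inside `U` or `V` is inside `U ∪ V`, and one inside both is inside `U ∩ V`. Against the
-- modularity of cardinality, this makes unions of tight sets tight.
tally-supermodular : (A : Fin k → Subset m) (U V : Subset m) →
                     tally A U + tally A V ≤ tally A (U ∪ V) + tally A (U ∩ V)
tally-supermodular {k} A U V = begin
  tally A U + tally A V
    ≡⟨ ∑-distrib-+ (λ j → 𝟙 (A j ⊆? U)) (λ j → 𝟙 (A j ⊆? V)) ⟨
  ∑[ j < k ] (𝟙 (A j ⊆? U) + 𝟙 (A j ⊆? V))
    ≤⟨ sum-mono pointwise ⟩
  ∑[ j < k ] (𝟙 (A j ⊆? U ∪ V) + 𝟙 (A j ⊆? U ∩ V))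
    ≡⟨ ∑-distrib-+ (λ j → 𝟙 (A j ⊆? U ∪ V)) (λ j → 𝟙 (A j ⊆? U ∩ V)) ⟩
  tally A (U ∪ V) + tally A (U ∩ V) ∎
  where
  open ≤-Reasoning
  pointwise : ∀ j → 𝟙 (A j ⊆? U) + 𝟙 (A j ⊆? V) ≤ 𝟙 (A j ⊆? U ∪ V) + 𝟙 (A j ⊆? U ∩ V)
  pointwise j with A j ⊆? U | A j ⊆? V
  ... | no _    | no _    = z≤n
  ... | no _    | yes A⊆V = ≤-trans (≤-reflexive (sym (𝟙-yes (A j ⊆? U ∪ V) (q⊆p∪q U V ∘ A⊆V)))) (m≤m+n _ _)
  ... | yes A⊆U | no _    = ≤-trans (≤-reflexive (sym (𝟙-yes (A j ⊆? U ∪ V) (p⊆p∪q V ∘ A⊆U)))) (m≤m+n _ _)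
  ... | yes A⊆U | yes A⊆V = ≤-reflexive (sym (cong₂ _+_
    (𝟙-yes (A j ⊆? U ∪ V) (p⊆p∪q V ∘ A⊆U))
    (𝟙-yes (A j ⊆? U ∩ V) (λ x∈A → x∈p∩q⁺ (A⊆U x∈A , A⊆V x∈A)))))

-- The tight sets of the remaining family are closed under union.  If they covered A₀, their union
-- would violate the condition, so some x ∈ A₀ lies in no tight set and can represent A₀.
hall : (A : Fin k → Subset m) → HallCondition A →
       Σ[ s ∈ (Fin k → Fin m) ] (Injective _≡_ _≡_ s × (∀ j → s j ∈ A j))
hall {zero}      A cond = (λ ()) , (λ { {()} }) , λ ()
hall {suc k} {m} A cond = extend (any? (λ x → x ∈? A zero ×-dec ¬? (covered? x)))
  where
  open ≤-Reasoning

  B : Fin k → Subset m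
  B = A ∘ suc

  condB : HallCondition B
  condB U = ≤-trans (m≤n+m _ (𝟙 (A zero ⊆? U))) (cond U)

  Tight : Subset m → Set
  Tight U = ∣ U ∣ ≤ tally B U

  Tight-∪ : ∀ {U V} → Tight U → Tight V → Tight (U ∪ V)
  Tight-∪ {U} {V} tU tV = +-cancelʳ-≤ ∣ U ∩ V ∣ _ _ (begin
    ∣ U ∪ V ∣ + ∣ U ∩ V ∣              ≡⟨ ∣p∪q∣+∣p∩q∣ U V ⟩
    ∣ U ∣ + ∣ V ∣                      ≤⟨ +-mono-≤ tU tV ⟩
    tally B U + tally B V              ≤⟨ tally-supermodular B U V ⟩
    tally B (U ∪ V) + tally B (U ∩ V)  ≤⟨ +-monoʳ-≤ _ (condB (U ∩ V)) ⟩
    tally B (U ∪ V) + ∣ U ∩ V ∣        ∎)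

  Tight-⊥ : Tight ⊥
  Tight-⊥ = ≤-trans (≤-reflexive (∣⊥∣≡0 m)) z≤n

  Tight-⋃ : ∀ {n} (W : Fin n → Subset m) → (∀ i → Tight (W i)) →
            ∃[ U ] (Tight U × (∀ i → W i ⊆ U))
  Tight-⋃ {zero}  W tW = ⊥ , Tight-⊥ , λ ()
  Tight-⋃ {suc n} W tW with Tight-⋃ (W ∘ suc) (tW ∘ suc)
  ... | U , tU , W⊆U = W zero ∪ U , Tight-∪ (tW zero) tU ,
    λ { zero → p⊆p∪q U ; (suc i) → q⊆p∪q (W zero) U ∘ W⊆U i }

  Covered : Fin m → Set
  Covered x = ∃[ U ] (x ∈ U × Tight U)

  covered? : ∀ x → Dec (Covered x)
  covered? x = anySubset? (λ U → x ∈? U ×-dec ∣ U ∣ ≤? tally B U)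

  all-covered-impossible : ¬ (∀ x → x ∈ A zero → Covered x)
  all-covered-impossible cover = violates (Tight-⋃ (proj₁ ∘ W) (proj₁ ∘ proj₂ ∘ W))
    where
    -- Points outside `A zero` get the tight set `⊥`, so that the union can run over all of `Fin m`.
    W : ∀ x → ∃[ U ] (Tight U × (x ∈ A zero → x ∈ U))
    W x with x ∈? A zero
    ... | yes x∈A = let U , x∈U , tU = cover x x∈A in U , tU , λ _ → x∈U
    ... | no x∉A  = ⊥ , Tight-⊥ , λ x∈A → contradiction x∈A x∉A

    violates : ¬ (∃[ U ] (Tight U × (∀ x → proj₁ (W x) ⊆ U)))
    -- A tight `U` already contains `∣ U ∣` sets of the remaining family, and `A zero` is one more.
    violates (U , tU , W⊆U) = <-irrefl refl (begin-strict
      ∣ U ∣          <⟨ s≤s tU ⟩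
      1 + tally B U  ≡⟨ cong (_+ tally B U) (𝟙-yes (A zero ⊆? U) A₀⊆U) ⟨
      tally A U      ≤⟨ cond U ⟩
      ∣ U ∣          ∎)
      where
      A₀⊆U : A zero ⊆ U
      A₀⊆U {x} x∈A = W⊆U x (proj₂ (proj₂ (W x)) x∈A)

  extend : Dec (∃[ x ] (x ∈ A zero × ¬ Covered x)) →
           Σ[ s ∈ (Fin (suc k) → Fin m) ] (Injective _≡_ _≡_ s × (∀ j → s j ∈ A j))
  extend (no ¬free) = contradiction
    (λ x x∈A → decidable-stable (covered? x) (λ ¬cov → ¬free (x , x∈A , ¬cov)))
    all-covered-impossible
  extend (yes (x , x∈A₀ , ¬cov)) with hall A′ condA′
    where
    A′ : Fin k → Subset m
    A′ j = B j ∩ ∁ ⁅ x ⁆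

    add-x : ∀ U j → A′ j ⊆ U → B j ⊆ ⁅ x ⁆ ∪ U
    add-x U j A′⊆U {y} y∈B with y ∈? ⁅ x ⁆
    ... | yes y∈x = p⊆p∪q U y∈x
    ... | no y∉x  = q⊆p∪q ⁅ x ⁆ U (A′⊆U (x∈p∩q⁺ (y∈B , x∉p⇒x∈∁p y∉x)))

    condA′ : HallCondition A′
    condA′ U with x ∈? U
    -- Deleting `x` does not affect which sets lie inside a `U` that contains `x`.
    ... | yes x∈U = begin
      tally A′ U  ≤⟨ tally-mono A′ B U U (λ j A′⊆U → absorb ∘ add-x U j A′⊆U) ⟩
      tally B U   ≤⟨ condB U ⟩
      ∣ U ∣       ∎
      where
      absorb : ⁅ x ⁆ ∪ U ⊆ U
      absorb y∈ = [ (λ y∈⁅x⁆ → subst (_∈ U) (sym (x∈⁅y⁆⇒x≡y x y∈⁅x⁆)) x∈U) , id ]′ (x∈p∪q⁻ ⁅ x ⁆ U y∈)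
    -- `⁅ x ⁆ ∪ U` contains the uncovered point `x`, so it is not tight; the strict inequality pays
    -- for the added element.
    ... | no x∉U = ≤-pred (begin-strict
      tally A′ U           ≤⟨ tally-mono A′ B U (⁅ x ⁆ ∪ U) (add-x U) ⟩
      tally B (⁅ x ⁆ ∪ U)  <⟨ ≰⇒> (λ tight → ¬cov (⁅ x ⁆ ∪ U , p⊆p∪q U (x∈⁅x⁆ x) , tight)) ⟩
      ∣ ⁅ x ⁆ ∪ U ∣        ≡⟨ ∣⁅x⁆∪p∣ U x∉U ⟩
      suc ∣ U ∣            ∎)
  ... | s , s-inj , s∈A′ = s′ , s′-inj , s′∈A
    where
    s′ : Fin (suc k) → Fin m
    s′ zero    = x
    s′ (suc j) = s j

    x≢s : ∀ j → x ≢ s j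
    x≢s j x≡s = x∈∁p⇒x∉p (proj₂ (x∈p∩q⁻ (B j) (∁ ⁅ x ⁆) (s∈A′ j))) (subst (_∈ ⁅ x ⁆) x≡s (x∈⁅x⁆ x))

    s′-inj : Injective _≡_ _≡_ s′
    s′-inj {zero}  {zero}  _ = refl
    s′-inj {zero}  {suc j} e = contradiction e (x≢s j)
    s′-inj {suc j} {zero}  e = contradiction (sym e) (x≢s j)
    s′-inj {suc i} {suc j} e = cong suc (s-inj e)

    s′∈A : ∀ j → s′ j ∈ A j
    s′∈A zero    = x∈A₀
    s′∈A (suc j) = proj₁ (x∈p∩q⁻ (B j) (∁ ⁅ x ⁆) (s∈A′ j))

-- Hall's theorem for `s` copies of `p`: a set `U` contains all of the copies, and then
-- `s ≤ ∣ p ∣ ≤ ∣ U ∣`, or none.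
choose : ∀ {s} (p : Subset m) → s ≤ ∣ p ∣ →
         Σ[ f ∈ (Fin s → Fin m) ] (Injective _≡_ _≡_ f × (∀ i → f i ∈ p))
choose {m} {s} p s≤∣p∣ = hall (λ _ → p) condition
  where
  condition : HallCondition {s} (λ _ → p)
  condition U with p ⊆? U
  ... | yes p⊆U = ≤-trans (≤-reflexive (trans (sum-const s) (*-identityʳ s))) (≤-trans s≤∣p∣ (p⊆q⇒∣p∣≤∣q∣ p⊆U))
  ... | no _    = ≤-trans (≤-reflexive (sum-replicate-zero s)) z≤n

-- Double counting of the pairs of a set `A i ⊆ U` and a point of it: each point of `U` occurs in at
-- most one pair.
disjoint-tally : ∀ {c} (A : Fin k → Subset m) → (∀ i → ∣ A i ∣ ≡ c) →
                 (∀ {i j x} → x ∈ A i → x ∈ A j → i ≡ j) → ∀ U → tally A U * c ≤ ∣ U ∣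
disjoint-tally {k} {m} {c} A size disjoint U = begin
  tally A U * c
    ≡⟨ *-distribʳ-sum c (λ i → 𝟙 (A i ⊆? U)) ⟩
  ∑[ i < k ] (𝟙 (A i ⊆? U) * c)
    ≡⟨ sum-cong-≗ expand ⟩
  ∑[ i < k ] ∑[ x < m ] 𝟙 (A i ⊆? U ×-dec x ∈? A i)
    ≡⟨ ∑-comm (λ i x → 𝟙 (A i ⊆? U ×-dec x ∈? A i)) ⟩
  ∑[ x < m ] ∑[ i < k ] 𝟙 (A i ⊆? U ×-dec x ∈? A i)
    ≤⟨ sum-mono (λ x → count≤𝟙 (λ i → A i ⊆? U ×-dec x ∈? A i) (x ∈? U)
                         (λ { (_ , x∈) (_ , x∈′) → disjoint x∈ x∈′ }) (λ { (A⊆U , x∈) → A⊆U x∈ })) ⟩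
  ∑[ x < m ] 𝟙 (x ∈? U)
    ≡⟨ ∣p∣≡sum U ⟨
  ∣ U ∣ ∎
  where
  open ≤-Reasoning
  expand : ∀ i → 𝟙 (A i ⊆? U) * c ≡ ∑[ x < m ] 𝟙 (A i ⊆? U ×-dec x ∈? A i)
  expand i = trans (cong (𝟙 (A i ⊆? U) *_) (sym (size i))) (sym (count-×∈ (A i ⊆? U) (A i)))

-- Transversal designs

another : 2 ≤ n → (i : Fin n) → ∃[ j ] i ≢ j
another (s≤s (s≤s z≤n)) zero    = suc zero , λ ()
another (s≤s (s≤s z≤n)) (suc i) = zero , λ ()

-- The number `s(s − 1)/2` of pairs among `s` points.
triangle : ℕ → ℕ
triangle zero    = 0
triangle (suc s) = s + triangle s

module Counting {ℓ h : ℕ} (2≤ℓ : 2 ≤ ℓ) (D : TransversalDesign ℓ h) where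
  open TransversalDesign D

  private
    M = ℓ * h
    b = blocks

  -- Let `j` be a group not containing `x`. Each block through `x` meets it in one point, and each
  -- of its points is joined to `x` by one block, so the blocks through `x` correspond to the `h`
  -- points of group `j`.
  degree : ∀ x → ∑[ β < b ] 𝟙 (x ∈? block β) ≡ h
  degree x with group-partition x
  ... | i , x∈i , _ with another 2≤ℓ i
  ...   | j , i≢j = begin
    ∑[ β < b ] 𝟙 (x ∈? block β)
      ≡⟨ sum-cong-≗ (λ β → sym (count-∃! (flag? β) (x ∈? block β) (meet β) proj₁)) ⟩
    ∑[ β < b ] ∑[ y < M ] 𝟙 (flag? β y)
      ≡⟨ ∑-comm (λ β y → 𝟙 (flag? β y)) ⟩
    ∑[ y < M ] ∑[ β < b ] 𝟙 (flag? β y)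
      ≡⟨ sum-cong-≗ (λ y → count-∃! (λ β → flag? β y) (y ∈? group j) (join y) (proj₂ ∘ proj₂)) ⟩
    ∑[ y < M ] 𝟙 (y ∈? group j)
      ≡⟨ ∣p∣≡sum (group j) ⟨
    ∣ group j ∣
      ≡⟨ group-size j ⟩
    h ∎
    where
    open ≡-Reasoning
    Flag : Fin b → Fin M → Set
    Flag β y = x ∈ block β × y ∈ block β × y ∈ group j

    flag? : ∀ β y → Dec (Flag β y)
    flag? β y = x ∈? block β ×-dec y ∈? block β ×-dec y ∈? group j

    meet : ∀ β → x ∈ block β → ∃! _≡_ (Flag β)
    meet β x∈β with block-meets β j
    ... | y , y∈ , unique = y , (x∈β , y∈) , unique ∘ proj₂

    join : ∀ y → y ∈ group j → ∃! _≡_ (λ β → Flag β y)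
    join y y∈j with cross-pair i≢j x∈i y∈j
    ... | β , (x∈β , y∈β) , unique =
      β , (x∈β , y∈β , y∈j) , λ { (x∈β′ , y∈β′ , _) → unique (x∈β′ , y∈β′) }

  -- Every block meets a fixed group exactly once, and each of the `h` points of that group lies on
  -- `h` blocks.
  blocks≡ : b ≡ h * h
  blocks≡ with another 2≤ℓ (inject≤ {1} zero (≤-trans (s≤s z≤n) 2≤ℓ))
  ... | i , _ = begin
    b
      ≡⟨ trans (sum-const b) (*-identityʳ b) ⟨
    ∑[ β < b ] 1
      ≡⟨ sum-cong-≗ (λ β → sym (count-∃! (λ x → x ∈? block β ×-dec x ∈? group i) (yes tt)
                                        (λ _ → block-meets β i) (λ _ → tt))) ⟩
    ∑[ β < b ] ∑[ x < M ] 𝟙 (x ∈? block β ×-dec x ∈? group i)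
      ≡⟨ ∑-comm (λ β x → 𝟙 (x ∈? block β ×-dec x ∈? group i)) ⟩
    ∑[ x < M ] ∑[ β < b ] 𝟙 (x ∈? block β ×-dec x ∈? group i)
      ≡⟨ sum-cong-≗ through ⟩
    ∑[ x < M ] (𝟙 (x ∈? group i) * h)
      ≡⟨ *-distribʳ-sum h (λ x → 𝟙 (x ∈? group i)) ⟨
    (∑[ x < M ] 𝟙 (x ∈? group i)) * h
      ≡⟨ cong (_* h) (trans (sym (∣p∣≡sum (group i))) (group-size i)) ⟩
    h * h ∎
    where
    open ≡-Reasoning
    through : ∀ x → ∑[ β < b ] 𝟙 (x ∈? block β ×-dec x ∈? group i) ≡ 𝟙 (x ∈? group i) * h
    through x = begin
      ∑[ β < b ] 𝟙 (x ∈? block β ×-dec x ∈? group i)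
        ≡⟨ sum-cong-≗ (λ β → 𝟙-× (x ∈? block β) (x ∈? group i)) ⟩
      ∑[ β < b ] (𝟙 (x ∈? block β) * 𝟙 (x ∈? group i))
        ≡⟨ *-distribʳ-sum (𝟙 (x ∈? group i)) (λ β → 𝟙 (x ∈? block β)) ⟨
      (∑[ β < b ] 𝟙 (x ∈? block β)) * 𝟙 (x ∈? group i)
        ≡⟨ cong (_* 𝟙 (x ∈? group i)) (degree x) ⟩
      h * 𝟙 (x ∈? group i)
        ≡⟨ *-comm h _ ⟩
      𝟙 (x ∈? group i) * h ∎

  -- Two points of the same group share no block, by `block-meets`; points of different groups share
  -- exactly one, by `cross-pair`.
  block-unique : ∀ {x y β β′} → x ≢ y → x ∈ block β × y ∈ block β → x ∈ block β′ × y ∈ block β′ → β ≡ β′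
  block-unique {x} {y} {β} x≢y (x∈β , y∈β) on-β′ with group-partition x | group-partition y
  ... | i , x∈i , _ | j , y∈j , _ with i ≟ᶠ j
  ...   | yes refl = let _ , _ , unique = block-meets β i in
                     contradiction (trans (sym (unique (x∈β , x∈i))) (unique (y∈β , y∈j))) x≢y
  ...   | no i≢j   = let _ , _ , unique = cross-pair i≢j x∈i y∈j in
                     trans (sym (unique (x∈β , y∈β))) (unique on-β′)

  avoids? : ∀ {s} (xs : Fin s → Fin M) β → Dec (∀ i → xs i ∉ block β)
  avoids? xs β = all? (λ i → ¬? (xs i ∈? block β))

  -- Bonferroni: each point lies in h blocks, and each pair of points in at most one.
  avoiding-≤ : ∀ {s} (xs : Fin s → Fin M) → Injective _≡_ _≡_ xs →
               ∑[ β < b ] 𝟙 (avoids? xs β) + s * h ≤ b + triangle s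
  avoiding-≤ {zero}  xs _ = +-monoˡ-≤ 0 (begin
    ∑[ β < b ] 𝟙 (avoids? xs β)  ≤⟨ sum-mono (λ β → 𝟙-mono (avoids? xs β) (yes tt) _) ⟩
    ∑[ β < b ] 1                 ≡⟨ trans (sum-const b) (*-identityʳ b) ⟩
    b                            ∎)
    where open ≤-Reasoning
  avoiding-≤ {suc s} xs xs-inj = begin
    A xs + (h + s * h)          ≡⟨ +-assoc (A xs) h (s * h) ⟨
    A xs + h + s * h            ≤⟨ +-monoˡ-≤ (s * h) step ⟩
    A ys + s + s * h            ≡⟨ rearrange (A ys) s (s * h) ⟩
    s + (A ys + s * h)          ≤⟨ +-monoʳ-≤ s (avoiding-≤ ys (suc-injective ∘ xs-inj)) ⟩
    s + (b + triangle s)        ≡⟨ rearrange′ s b (triangle s) ⟩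
    b + (s + triangle s)        ∎
    where
    open ≤-Reasoning
    x = xs zero
    ys = xs ∘ suc

    A : ∀ {s} → (Fin s → Fin M) → ℕ
    A xs = ∑[ β < b ] 𝟙 (avoids? xs β)

    rearrange : ∀ a b c → a + b + c ≡ b + (a + c)
    rearrange = solve-∀

    rearrange′ : ∀ a b c → a + (b + c) ≡ b + (a + c)
    rearrange′ = solve-∀

    pair? : ∀ β i → Dec (x ∈ block β × ys i ∈ block β)
    pair? β i = x ∈? block β ×-dec ys i ∈? block β

    -- A block through `x` adds 1 on the left. It either avoids all of `ys` or forms a pair with
    -- some `ys i`, which pays for it on the right.
    pointwise : ∀ β → 𝟙 (avoids? xs β) + 𝟙 (x ∈? block β) ≤
                      𝟙 (avoids? ys β) + ∑[ i < s ] 𝟙 (pair? β i)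
    pointwise β = by-cases (x ∈? block β) (any? (λ i → ys i ∈? block β))
      where
      at-most-one : x ∈ block β → 𝟙 (avoids? xs β) + 1 ≤ 1
      at-most-one x∈β = ≤-reflexive (cong (_+ 1) (𝟙-no (avoids? xs β) (λ avoid → avoid zero x∈β)))

      by-cases : (x∈? : Dec (x ∈ block β)) → Dec (∃[ i ] ys i ∈ block β) →
                 𝟙 (avoids? xs β) + 𝟙 x∈? ≤ 𝟙 (avoids? ys β) + ∑[ i < s ] 𝟙 (pair? β i)
      by-cases (no _) _ = ≤-trans (≤-reflexive (+-identityʳ _))
        (≤-trans (𝟙-mono (avoids? xs β) (avoids? ys β) (_∘ suc)) (m≤m+n _ _))
      by-cases (yes x∈β) (no none) = ≤-trans (at-most-one x∈β)
        (≤-trans (≤-reflexive (sym (𝟙-yes (avoids? ys β) (λ i y∈β → none (i , y∈β))))) (m≤m+n _ _))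
      by-cases (yes x∈β) (yes (i , y∈β)) = ≤-trans (at-most-one x∈β)
        (≤-trans (≤-reflexive (sym (𝟙-yes (pair? β i) (x∈β , y∈β))))
          (≤-trans (term≤sum (λ i → 𝟙 (pair? β i)) i) (m≤n+m _ _)))

    step : A xs + h ≤ A ys + s
    step = begin
      A xs + h
        ≡⟨ cong (A xs +_) (degree x) ⟨
      A xs + ∑[ β < b ] 𝟙 (x ∈? block β)
        ≡⟨ ∑-distrib-+ (λ β → 𝟙 (avoids? xs β)) (λ β → 𝟙 (x ∈? block β)) ⟨
      ∑[ β < b ] (𝟙 (avoids? xs β) + 𝟙 (x ∈? block β))
        ≤⟨ sum-mono pointwise ⟩
      ∑[ β < b ] (𝟙 (avoids? ys β) + ∑[ i < s ] 𝟙 (pair? β i))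
        ≡⟨ ∑-distrib-+ (λ β → 𝟙 (avoids? ys β)) (λ β → ∑[ i < s ] 𝟙 (pair? β i)) ⟩
      A ys + ∑[ β < b ] ∑[ i < s ] 𝟙 (pair? β i)
        ≡⟨ cong (A ys +_) (∑-comm (λ β i → 𝟙 (pair? β i))) ⟩
      A ys + ∑[ i < s ] ∑[ β < b ] 𝟙 (pair? β i)
        ≤⟨ +-monoʳ-≤ (A ys) (sum-mono (λ i → count≤𝟙 (λ β → pair? β i) (yes tt)
             (block-unique (λ e → contradiction (xs-inj e) λ ())) (λ _ → tt))) ⟩
      A ys + ∑[ i < s ] 1
        ≡⟨ cong (A ys +_) (trans (sum-const s) (*-identityʳ s)) ⟩
      A ys + s ∎

  -- Blocks inside `U` avoid any `s` points chosen from its complement.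
  inside-≤ : ∀ s U → s ≤ ∣ ∁ U ∣ → tally block U + s * h ≤ b + triangle s
  inside-≤ s U s≤ with choose (∁ U) s≤
  ... | xs , xs-inj , xs∉U = ≤-trans
    (+-monoˡ-≤ (s * h) (sum-mono (λ β → 𝟙-mono (block β ⊆? U) (avoids? xs β)
      (λ β⊆U i x∈β → x∈∁p⇒x∉p (xs∉U i) (β⊆U x∈β)))))
    (avoiding-≤ xs xs-inj)

  -- Flags `(x , β)` with `β ⊆ U` are counted twice: each block contributes `ℓ` of them, and each
  -- point of `U` at most `d = ℓ − 1`, as more blocks through one point would not fit into `U`.
  inside-sparse : ∀ d U → ℓ ≡ suc d → ∣ U ∣ ≤ ℓ * d → tally block U * ℓ ≤ d * ∣ U ∣
  inside-sparse d U refl ∣U∣≤ = begin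
    tally block U * ℓ
      ≡⟨ *-distribʳ-sum ℓ (λ β → 𝟙 (block β ⊆? U)) ⟩
    ∑[ β < b ] (𝟙 (block β ⊆? U) * ℓ)
      ≡⟨ sum-cong-≗ (λ β → trans (cong (𝟙 (block β ⊆? U) *_) (sym (block-size β)))
                                 (sym (count-×∈ (block β ⊆? U) (block β)))) ⟩
    ∑[ β < b ] ∑[ x < M ] 𝟙 (through? x β)
      ≡⟨ ∑-comm (λ β x → 𝟙 (through? x β)) ⟩
    ∑[ x < M ] ρ x
      ≤⟨ sum-mono ρ≤ ⟩
    ∑[ x < M ] (d * 𝟙 (x ∈? U))
      ≡⟨ *-distribˡ-sum d (λ x → 𝟙 (x ∈? U)) ⟨
    d * (∑[ x < M ] 𝟙 (x ∈? U))
      ≡⟨ cong (d *_) (∣p∣≡sum U) ⟨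
    d * ∣ U ∣ ∎
    where
    open ≤-Reasoning
    through? : ∀ x β → Dec (block β ⊆ U × x ∈ block β)
    through? x β = block β ⊆? U ×-dec x ∈? block β

    ρ : Fin M → ℕ
    ρ x = ∑[ β < b ] 𝟙 (through? x β)

    -- The blocks of U through x meet only in x.
    fan : ∀ x → x ∈ U → ρ x * ℓ + 1 ≤ ∣ U ∣ + ρ x
    fan x x∈U = begin
      ρ x * ℓ + 1
        ≡⟨ cong₂ _+_ ρℓ≡ (sym δ-sum) ⟩
      ∑[ y < M ] c y + ∑[ y < M ] 𝟙 (x ≟ᶠ y)
        ≡⟨ ∑-distrib-+ c (λ y → 𝟙 (x ≟ᶠ y)) ⟨
      ∑[ y < M ] (c y + 𝟙 (x ≟ᶠ y))
        ≤⟨ sum-mono pointwise ⟩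
      ∑[ y < M ] (𝟙 (y ∈? U) + 𝟙 (x ≟ᶠ y) * ρ x)
        ≡⟨ ∑-distrib-+ (λ y → 𝟙 (y ∈? U)) (λ y → 𝟙 (x ≟ᶠ y) * ρ x) ⟩
      ∑[ y < M ] 𝟙 (y ∈? U) + ∑[ y < M ] (𝟙 (x ≟ᶠ y) * ρ x)
        ≡⟨ cong₂ _+_ (sym (∣p∣≡sum U)) (trans (sym (*-distribʳ-sum (ρ x) (λ y → 𝟙 (x ≟ᶠ y)))) (cong (_* ρ x) δ-sum)) ⟩
      ∣ U ∣ + 1 * ρ x
        ≡⟨ cong (∣ U ∣ +_) (*-identityˡ (ρ x)) ⟩
      ∣ U ∣ + ρ x ∎
      where
      on? : ∀ y β → Dec ((block β ⊆ U × x ∈ block β) × y ∈ block β)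
      on? y β = through? x β ×-dec y ∈? block β

      c : Fin M → ℕ
      c y = ∑[ β < b ] 𝟙 (on? y β)

      δ-sum : ∑[ y < M ] 𝟙 (x ≟ᶠ y) ≡ 1
      δ-sum = count-∃! (x ≟ᶠ_) (yes tt) (λ _ → x , refl , id) (λ _ → tt)

      ρℓ≡ : ρ x * ℓ ≡ ∑[ y < M ] c y
      ρℓ≡ = begin-equality
        ρ x * ℓ
          ≡⟨ *-distribʳ-sum ℓ (λ β → 𝟙 (through? x β)) ⟩
        ∑[ β < b ] (𝟙 (through? x β) * ℓ)
          ≡⟨ sum-cong-≗ (λ β → trans (cong (𝟙 (through? x β) *_) (sym (block-size β)))
                                     (sym (count-×∈ (through? x β) (block β)))) ⟩
        ∑[ β < b ] ∑[ y < M ] 𝟙 (on? y β)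
          ≡⟨ ∑-comm (λ β y → 𝟙 (on? y β)) ⟩
        ∑[ y < M ] c y ∎

      -- At `y = x` all `ρ x` blocks are counted; any other point of `U` is on at most one of them.
      -- The deltas correct for `x` without subtraction.
      pointwise : ∀ y → c y + 𝟙 (x ≟ᶠ y) ≤ 𝟙 (y ∈? U) + 𝟙 (x ≟ᶠ y) * ρ x
      pointwise y with x ≟ᶠ y
      ... | yes refl = begin
        c x + 1                      ≤⟨ +-monoˡ-≤ 1 (sum-mono (λ β → 𝟙-mono (on? x β) (through? x β) proj₁)) ⟩
        ρ x + 1                      ≡⟨ +-comm (ρ x) 1 ⟩
        1 + ρ x                      ≡⟨ cong₂ _+_ (𝟙-yes (x ∈? U) x∈U) (*-identityˡ (ρ x)) ⟨
        𝟙 (x ∈? U) + 1 * ρ x         ∎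
      ... | no x≢y = +-monoˡ-≤ 0 (count≤𝟙 (on? y) (y ∈? U)
        (λ { ((_ , x∈β) , y∈β) ((_ , x∈β′) , y∈β′) → block-unique x≢y (x∈β , y∈β) (x∈β′ , y∈β′) })
        (λ { ((β⊆U , _) , y∈β) → β⊆U y∈β }))

    ρ≤ : ∀ x → ρ x ≤ d * 𝟙 (x ∈? U)
    ρ≤ x with x ∈? U
    ... | no x∉U = begin
      ρ x           ≡⟨ trans (sum-cong-≗ (λ β → 𝟙-no (through? x β) λ { (β⊆U , x∈β) → x∉U (β⊆U x∈β) })) (sum-replicate-zero b) ⟩
      0             ≤⟨ z≤n ⟩
      d * 0         ∎
    -- Cancelling first `ρ x` and then `d` leaves `ρ x < ℓ`, that is, `ρ x ≤ d`.
    ... | yes x∈U = ≤-trans (≤-pred (*-cancelʳ-< d (ρ x) ℓ (+-cancelʳ-< (ρ x) _ _ (begin-strict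
      ρ x * d + ρ x  ≡⟨ trans (+-comm _ (ρ x)) (sym (*-suc (ρ x) d)) ⟩
      ρ x * ℓ        <⟨ ≤-reflexive (+-comm 1 _) ⟩
      ρ x * ℓ + 1    ≤⟨ fan x x∈U ⟩
      ∣ U ∣ + ρ x    ≤⟨ +-monoˡ-≤ (ρ x) ∣U∣≤ ⟩
      ℓ * d + ρ x    ∎)))) (≤-reflexive (sym (*-identityʳ d)))

-- Punctured groups

-- Shaped so that `punctured p i` is by computation `image (point i ∘ suc)` once the group size is a
-- successor.
image : (Fin k → Fin n) → Subset n
image f = ⋃ (map ⁅_⁆ (tabulate f))

∈-image⁻ : (f : Fin k → Fin n) → ∀ {x} → x ∈ image f → ∃[ j ] x ≡ f j
∈-image⁻ {zero}  f x∈ = contradiction x∈ ∉⊥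
∈-image⁻ {suc k} f x∈ with x∈p∪q⁻ ⁅ f zero ⁆ (image (f ∘ suc)) x∈
... | inj₁ x∈⁅f0⁆ = zero , x∈⁅y⁆⇒x≡y (f zero) x∈⁅f0⁆
... | inj₂ x∈′    = let j , x≡ = ∈-image⁻ (f ∘ suc) x∈′ in suc j , x≡

∣image∣ : (f : Fin k → Fin n) → Injective _≡_ _≡_ f → ∣ image f ∣ ≡ k
∣image∣ {zero} {n} f f-inj = ∣⊥∣≡0 n
∣image∣ {suc k}    f f-inj = trans
  (∣⁅x⁆∪p∣ (image (f ∘ suc)) (λ f0∈ → let j , f0≡ = ∈-image⁻ (f ∘ suc) f0∈ in contradiction (f-inj f0≡) λ ()))
  (cong suc (∣image∣ (f ∘ suc) (suc-injective ∘ f-inj)))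

module _ {ℓ h : ℕ} {D : TransversalDesign ℓ (suc h)} (p : Labelling D) where
  open TransversalDesign D
  open Labelling p

  ∣punctured∣ : ∀ i → ∣ punctured p i ∣ ≡ h
  ∣punctured∣ i = ∣image∣ (point i ∘ suc) (suc-injective ∘ point-injective i)

  punctured⊆group : ∀ i → punctured p i ⊆ group i
  punctured⊆group i {x} x∈ = let j , x≡ = ∈-image⁻ (point i ∘ suc) x∈ in
    Equivalence.from (group-points i x) (suc j , x≡)

  punctured-disjoint : ∀ {i j x} → x ∈ punctured p i → x ∈ punctured p j → i ≡ j
  punctured-disjoint {i} {j} {x} x∈i x∈j = let _ , _ , unique = group-partition x in
    trans (sym (unique (punctured⊆group i x∈i))) (unique (punctured⊆group j x∈j))

-- The code

sumˡ-const : ∀ {c} (f : Fin n → ℕ) → (∀ i → f i ≡ c) → sumˡ (tabulate f) ≡ n * c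
sumˡ-const {zero}  f f≡c = refl
sumˡ-const {suc n} f f≡c = cong₂ _+_ (f≡c zero) (sumˡ-const (f ∘ suc) (f≡c ∘ suc))

q^2≡q*q : ∀ q → q ^ 2 ≡ q * q
q^2≡q*q q = cong (q *_) (*-identityʳ q)

points≡ : ∀ q → (q ∸ 1) * q ≡ q ^ 2 ∸ q
points≡ q = trans (*-distribʳ-∸ q q 1) (cong₂ _∸_ (sym (q^2≡q*q q)) (*-identityˡ q))

-- Writing `q = 3 + a` lets `q ∸ 1` and `q ∸ 3` compute to `2 + a` and `a`.
module Code (a : ℕ) (D : TransversalDesign (2 + a) (3 + a)) (p : Labelling D) where
  open TransversalDesign D using (blocks; block; block-size)
  open Counting (s≤s (s≤s z≤n)) D

  q ℓ M : ℕ
  q = 3 + a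
  ℓ = 2 + a
  M = ℓ * q

  open BatchCode (C₂ q D p)

  extra : Fin a → Subset M
  extra i = punctured p (inject≤ i (∸-monoʳ-≤ q (s≤s (z≤n {2}))))

  ∣extra∣ : ∀ i → ∣ extra i ∣ ≡ ℓ
  ∣extra∣ i = ∣punctured∣ p _

  extra-disjoint : ∀ {i j x} → x ∈ extra i → x ∈ extra j → i ≡ j
  extra-disjoint x∈i x∈j = inject≤-injective _ _ _ _ (punctured-disjoint p x∈i x∈j)

  uniform : Uniform ℓ (C₂ q D p)
  uniform j with splitAt blocks j
  ... | inj₁ β = block-size β
  ... | inj₂ i = ∣extra∣ i

  items≡n : items ≡ q ^ 2 + q ∸ 3
  items≡n = trans (cong (_+ a) (trans blocks≡ (sym (q^2≡q*q q))))
                  (sym (+-∸-assoc (q ^ 2) {q} (s≤s (s≤s (s≤s z≤n)))))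

  storage≡N : totalStorage ≡ (q ∸ 1) * (q ^ 2 + q ∸ 3)
  storage≡N = trans (sumˡ-const (λ j → ∣ store j ∣) uniform)
                    (trans (*-comm items ℓ) (cong (ℓ *_) items≡n))

  tally-store : ∀ U → tally store U ≡ tally block U + tally extra U
  tally-store U = sum-++ blocks (λ v → 𝟙 ([ block , extra ]′ v ⊆? U))

  extra-≤ : ∀ U → tally extra U ≤ a
  extra-≤ U = begin
    tally extra U   ≤⟨ sum-mono (λ i → 𝟙-mono (extra i ⊆? U) (yes tt) _) ⟩
    ∑[ i < a ] 1    ≡⟨ trans (sum-const a) (*-identityʳ a) ⟩
    a               ∎
    where open ≤-Reasoning

  M≡ : ∀ U → M ≡ ∣ U ∣ + ∣ ∁ U ∣
  M≡ U = sym (trans (cong (∣ U ∣ +_) (∣∁p∣≡n∸∣p∣ U)) (m+[n∸m]≡n (∣p∣≤n U)))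

  -- Here `r` is the largest number of missing servers that the Bonferroni bound with `s` points
  -- tolerates when all `a` punctured groups are counted too: `eq` says that the bound is exactly
  -- `M − r`.
  few-missing : ∀ s r U → q * q + triangle s + a + r ≡ M + s * q →
                s ≤ ∣ ∁ U ∣ → ∣ ∁ U ∣ ≤ r → tally store U ≤ ∣ U ∣
  few-missing s r U eq s≤t t≤r = +-cancelʳ-≤ (s * q + r) _ _ (begin
    tally store U + (s * q + r)
      ≡⟨ cong (_+ (s * q + r)) (tally-store U) ⟩
    tally block U + tally extra U + (s * q + r)
      ≡⟨ rearrange (tally block U) (tally extra U) (s * q) r ⟩
    tally block U + s * q + tally extra U + r
      ≤⟨ +-monoˡ-≤ r (+-mono-≤ (inside-≤ s U s≤t) (extra-≤ U)) ⟩
    blocks + triangle s + a + r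
      ≡⟨ cong (λ b → b + triangle s + a + r) blocks≡ ⟩
    q * q + triangle s + a + r
      ≡⟨ eq ⟩
    M + s * q
      ≡⟨ cong (_+ s * q) (M≡ U) ⟩
    ∣ U ∣ + ∣ ∁ U ∣ + s * q
      ≤⟨ +-monoˡ-≤ (s * q) (+-monoʳ-≤ ∣ U ∣ t≤r) ⟩
    ∣ U ∣ + r + s * q
      ≡⟨ rearrange′ ∣ U ∣ r (s * q) ⟩
    ∣ U ∣ + (s * q + r) ∎)
    where
    open ≤-Reasoning
    rearrange : ∀ x y z w → x + y + (z + w) ≡ x + z + y + w
    rearrange = solve-∀
    rearrange′ : ∀ x y z → x + y + z ≡ x + (z + y)
    rearrange′ = solve-∀

  -- The threshold `4 + 2a = 2q − 2` is what brings `∣ U ∣` down to `(q − 1)(q − 2)`. After scaling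
  -- by `ℓ = q − 1`, blocks contribute at most `(q − 2)∣ U ∣` and punctured groups at most `∣ U ∣`.
  many-missing : ∀ U → 4 + 2 * a ≤ ∣ ∁ U ∣ → tally store U ≤ ∣ U ∣
  many-missing U t≥ = *-cancelʳ-≤ _ _ ℓ (begin
    tally store U * ℓ
      ≡⟨ cong (_* ℓ) (tally-store U) ⟩
    (tally block U + tally extra U) * ℓ
      ≡⟨ *-distribʳ-+ ℓ (tally block U) (tally extra U) ⟩
    tally block U * ℓ + tally extra U * ℓ
      ≤⟨ +-mono-≤ (inside-sparse (1 + a) U refl ∣U∣≤) (disjoint-tally extra ∣extra∣ extra-disjoint U) ⟩
    (1 + a) * ∣ U ∣ + ∣ U ∣
      ≡⟨ trans (+-comm _ ∣ U ∣) (*-comm ℓ ∣ U ∣) ⟩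
    ∣ U ∣ * ℓ ∎)
    where
    open ≤-Reasoning
    split : ∀ a → (2 + a) * (3 + a) ≡ (2 + a) * (1 + a) + (4 + 2 * a)
    split = solve-∀
    ∣U∣≤ : ∣ U ∣ ≤ ℓ * (1 + a)
    ∣U∣≤ = +-cancelʳ-≤ (4 + 2 * a) _ _ (begin
      ∣ U ∣ + (4 + 2 * a)  ≤⟨ +-monoʳ-≤ ∣ U ∣ t≥ ⟩
      ∣ U ∣ + ∣ ∁ U ∣      ≡⟨ M≡ U ⟨
      M                    ≡⟨ split a ⟩
      ℓ * (1 + a) + (4 + 2 * a) ∎)

  store-condition : ∀ U → 2 ≤ ∣ ∁ U ∣ → tally store U ≤ ∣ U ∣
  -- The thresholds `2`, `q` and `2q − 3` are the values of `r` in `few-missing` for `s = 2, 3, 4`.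
  store-condition U 2≤t with ∣ ∁ U ∣ ≤? 2 | ∣ ∁ U ∣ ≤? q | ∣ ∁ U ∣ ≤? 3 + 2 * a
  ... | yes t≤2 | _       | _       = few-missing 2 2 U (eq a) 2≤t t≤2
    where
    eq : ∀ a → (3 + a) * (3 + a) + 1 + a + 2 ≡ (2 + a) * (3 + a) + 2 * (3 + a)
    eq = solve-∀
  ... | no t≰2  | yes t≤q | _       = few-missing 3 q U (eq a) (≰⇒> t≰2) t≤q
    where
    eq : ∀ a → (3 + a) * (3 + a) + 3 + a + (3 + a) ≡ (2 + a) * (3 + a) + 3 * (3 + a)
    eq = solve-∀
  ... | no _    | no t≰q  | yes t≤r = few-missing 4 (3 + 2 * a) U (eq a) (≤-trans (m≤m+n 4 a) (≰⇒> t≰q)) t≤r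
    where
    eq : ∀ a → (3 + a) * (3 + a) + 6 + a + (3 + 2 * a) ≡ (2 + a) * (3 + a) + 4 * (3 + a)
    eq = solve-∀
  ... | no _    | no _    | no t≰r  = many-missing U (≰⇒> t≰r)

  retrieval-condition : (i : Fin (q ^ 2 ∸ q ∸ 1) → Fin items) → Injective _≡_ _≡_ i →
                        HallCondition (store ∘ i)
  retrieval-condition i i-inj U with 2 ≤? ∣ ∁ U ∣
  ... | yes 2≤t = ≤-trans (sum-injective-≤ (λ j → 𝟙 (store j ⊆? U)) i i-inj) (store-condition U 2≤t)
  -- With at most one server missing, `∣ U ∣ ≥ M − 1 = k`, so the number of requested items is
  -- itself a sufficient bound.
  ... | no 2≰t  = ≤-pred (begin
    1 + tally (store ∘ i) U         ≤⟨ s≤s (sum-mono (λ j → 𝟙-mono (store (i j) ⊆? U) (yes tt) _)) ⟩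
    1 + ∑[ j < K ] 1                ≡⟨ cong suc (trans (sum-const K) (*-identityʳ K)) ⟩
    1 + K                           ≡⟨ cong (λ m → 1 + (m ∸ 1)) (points≡ q) ⟨
    M                               ≡⟨ M≡ U ⟩
    ∣ U ∣ + ∣ ∁ U ∣                 ≤⟨ +-monoʳ-≤ ∣ U ∣ (≤-pred (≰⇒> 2≰t)) ⟩
    ∣ U ∣ + 1                       ≡⟨ +-comm ∣ U ∣ 1 ⟩
    1 + ∣ U ∣                       ∎)
    where
    open ≤-Reasoning
    K = q ^ 2 ∸ q ∸ 1

  isCBC : IsCBC (q ^ 2 + q ∸ 3) ((q ∸ 1) * (q ^ 2 + q ∸ 3)) (q ^ 2 ∸ q ∸ 1) (q ^ 2 ∸ q) (C₂ q D p)
  isCBC = record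
    { items≡      = items≡n
    ; storage≡    = storage≡N
    ; servers≡    = points≡ q
    ; retrievable = λ i i-inj → hall (store ∘ i) (retrieval-condition i i-inj)
    }

-- The upper bound

-- A form of the factorial formula without division, so that later identities are polynomial.
C-factorials : ∀ c r → ((c + r) C c) * (c ! * r !) ≡ (c + r) !
C-factorials c r = subst (λ t → ((c + r) C c) * (c ! * t !) ≡ (c + r) !) (m+n∸m≡n c r) (begin
  ((c + r) C c) * d      ≡⟨ cong (_* d) (nCk≡n!/k![n-k]! (m≤m+n c r)) ⟩
  ((c + r) ! / d) * d  ≡⟨ m/n*n≡m (k![n∸k]!∣n! (m≤m+n c r)) ⟩
  (c + r) !            ∎)
  where
  open ≡-Reasoning
  d = c ! * (c + r ∸ c) !
  instance _ = c !* (c + r ∸ c) !≢0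

C-sucˡ : ∀ c r → (suc (c + r) C c) * suc r ≡ suc (c + r) * ((c + r) C c)
C-sucˡ c r = *-cancelʳ-≡ _ _ (c ! * r !) (begin
  (suc (c + r) C c) * suc r * (c ! * r !)      ≡⟨ rearrange (suc (c + r) C c) (suc r) (c !) (r !) ⟩
  (suc (c + r) C c) * (c ! * (suc r) !)        ≡⟨ cong (λ n → (n C c) * (c ! * (suc r) !)) (+-suc c r) ⟨
  ((c + suc r) C c) * (c ! * (suc r) !)        ≡⟨ C-factorials c (suc r) ⟩
  (c + suc r) !                              ≡⟨ cong _! (+-suc c r) ⟩
  suc (c + r) * (c + r) !                    ≡⟨ cong (suc (c + r) *_) (C-factorials c r) ⟨
  suc (c + r) * (((c + r) C c) * (c ! * r !))  ≡⟨ *-assoc (suc (c + r)) ((c + r) C c) (c ! * r !) ⟨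
  suc (c + r) * ((c + r) C c) * (c ! * r !)  ∎)
  where
  open ≡-Reasoning
  instance _ = c !* r !≢0
  rearrange : ∀ x s c! r! → x * s * (c! * r!) ≡ x * (c! * (s * r!))
  rearrange = solve-∀

-- Two steps are needed because `k − 1 = m − 2`: this links the binomial coefficient in the
-- numerator of the bound to its divisor.
C-sucˡ² : ∀ c r → ((2 + (c + r)) C c) * (2 + r) * (1 + r) ≡ (2 + (c + r)) * (1 + (c + r)) * ((c + r) C c)
C-sucˡ² c r = begin
  ((2 + (c + r)) C c) * (2 + r) * (1 + r)
    ≡⟨ cong (λ n → ((1 + n) C c) * (2 + r) * (1 + r)) (+-suc c r) ⟨
  ((1 + (c + suc r)) C c) * (2 + r) * (1 + r)
    ≡⟨ cong (_* (1 + r)) (C-sucˡ c (suc r)) ⟩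
  (1 + (c + suc r)) * ((c + suc r) C c) * (1 + r)
    ≡⟨ cong (λ n → (1 + n) * (n C c) * (1 + r)) (+-suc c r) ⟩
  (2 + (c + r)) * ((1 + (c + r)) C c) * (1 + r)
    ≡⟨ *-assoc (2 + (c + r)) ((1 + (c + r)) C c) (1 + r) ⟩
  (2 + (c + r)) * (((1 + (c + r)) C c) * (1 + r))
    ≡⟨ cong ((2 + (c + r)) *_) (C-sucˡ c r) ⟩
  (2 + (c + r)) * ((1 + (c + r)) * ((c + r) C c))
    ≡⟨ *-assoc (2 + (c + r)) (1 + (c + r)) ((c + r) C c) ⟨
  (2 + (c + r)) * (1 + (c + r)) * ((c + r) C c) ∎
  where open ≡-Reasoning

/-unique : ∀ {m n t} .{{_ : NonZero n}} → t * n ≤ m → m < suc t * n → m / n ≡ t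
/-unique {m} {n} {t} tn≤m m< = ≤-antisym (≤-pred (m<n*o⇒m/o<n m<))
  (≤-trans (≤-reflexive (sym (m*n/n≡m t n))) (/-monoˡ-≤ n tn≤m))

-- For q = 3 + a, multiplying by q − 1 = 2 + a clears the denominator of the bound: its numerator
-- is then (q − 1)(q² + q − 2) + (q − 3) times the divisor X.
upperBound-value : ∀ a {m c k} .(c<k : c < k) → c ≡ 2 + a → m ≡ (2 + a) * (3 + a) → k ≡ m ∸ 1 →
                   upperBound m c k c<k ≡ (2 + a) * (5 + a)
upperBound-value a {m} {c} {k} c<k refl m≡ k≡ = /-unique
  {{nCk-nonZero (∸-monoˡ-≤ 1 c<k)}}
  (*-cancelˡ-≤ (2 + a) (begin
    (2 + a) * (T * ((k ∸ 1) C c))   ≡⟨ cong (λ n → (2 + a) * (T * (n C c))) k-1≡ ⟩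
    (2 + a) * (T * X)               ≤⟨ m≤m+n _ (a * X) ⟩
    (2 + a) * (T * X) + a * X       ≡⟨ key ⟨
    (2 + a) * ((k ∸ 1) * (m C c))   ∎))
  (*-cancelˡ-< (2 + a) _ _ (begin-strict
    (2 + a) * ((k ∸ 1) * (m C c))   ≡⟨ key ⟩
    -- The remainder `(q − 3)X` is smaller than `(q − 1)X` because `X` is nonzero.
    (2 + a) * (T * X) + a * X       <⟨ +-monoʳ-< ((2 + a) * (T * X)) (*-monoˡ-< X {a} {2 + a} (m<n+m a (s≤s z≤n))) ⟩
    (2 + a) * (T * X) + (2 + a) * X ≡⟨ rearrange (2 + a) T X ⟩
    (2 + a) * (suc T * X)           ≡⟨ cong (λ n → (2 + a) * (suc T * (n C c))) k-1≡ ⟨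
    (2 + a) * (suc T * ((k ∸ 1) C c)) ∎))
  where
  open ≤-Reasoning
  -- In terms of `q`, `r = m − 2 − c = q² − 2q − 1`, and `T = q² + q − 2` is the value of the bound.
  r = 2 + 4 * a + a * a
  T = (2 + a) * (5 + a)
  X = (c + r) C c
  Y = (2 + (c + r)) C c

  instance
    X≢0 : NonZero X
    X≢0 = nCk-nonZero (m≤m+n c r)

  m≡2+ : m ≡ 2 + (c + r)
  m≡2+ = trans m≡ (eq a)
    where
    eq : ∀ a → (2 + a) * (3 + a) ≡ 2 + (2 + a + (2 + 4 * a + a * a))
    eq = solve-∀

  k-1≡ : k ∸ 1 ≡ c + r
  k-1≡ = cong (_∸ 1) (trans k≡ (cong (_∸ 1) m≡2+))

  rearrange : ∀ u t x → u * (t * x) + u * x ≡ u * (suc t * x)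
  rearrange = solve-∀

  key : (2 + a) * ((k ∸ 1) * (m C c)) ≡ (2 + a) * (T * X) + a * X
  key = trans (cong₂ (λ n m → (2 + a) * (n * (m C c))) k-1≡ m≡2+)
    -- The extra factor `m = (q − 1)q` brings in `(2 + r)(1 + r)`, since `2 + r = (q − 1)²`,
    -- `1 + r = q(q − 2)` and `c + r = (q − 2)(q + 1)`.
    (*-cancelˡ-≡ _ _ ((2 + a) * (3 + a)) (begin-equality
      (2 + a) * (3 + a) * ((2 + a) * ((c + r) * Y))
        ≡⟨ left a Y ⟩
      (4 + a) * (Y * (2 + r) * (1 + r))
        ≡⟨ cong ((4 + a) *_) (C-sucˡ² c r) ⟩
      (4 + a) * ((2 + (c + r)) * (1 + (c + r)) * X)
        ≡⟨ right a X ⟩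
      (2 + a) * (3 + a) * ((2 + a) * (T * X) + a * X) ∎))
    where
    left : ∀ a Y → (2 + a) * (3 + a) * ((2 + a) * ((2 + a + (2 + 4 * a + a * a)) * Y)) ≡
                   (4 + a) * (Y * (2 + (2 + 4 * a + a * a)) * (1 + (2 + 4 * a + a * a)))
    left = solve-∀
    right : ∀ a X → (4 + a) * ((2 + (2 + a + (2 + 4 * a + a * a))) * (1 + (2 + a + (2 + 4 * a + a * a))) * X) ≡
                    (2 + a) * (3 + a) * ((2 + a) * ((2 + a) * (5 + a) * X) + a * X)
    right = solve-∀

theorem20 : (q : ℕ) (3≤q : 3 ≤ q) → PrimePower q →
    (D : TransversalDesign (q ∸ 1) q) → Resolution D → (p : Labelling D) →
    Uniform (q ∸ 1) (C₂ q D p)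
    × IsCBC (q ^ 2 + q ∸ 3) ((q ∸ 1) * (q ^ 2 + q ∸ 3)) (q ^ 2 ∸ q ∸ 1) (q ^ 2 ∸ q) (C₂ q D p)
    × upperBound (q ^ 2 ∸ q) (q ∸ 1) (q ^ 2 ∸ q ∸ 1) (C₂-bound-defined 3≤q) ∸ (q ^ 2 + q ∸ 3) ≡ 1
theorem20 (suc (suc (suc a))) 3≤q@(s≤s (s≤s (s≤s z≤n))) _ D _ p =
  Code.uniform a D p , Code.isCBC a D p , (begin
    upperBound (q ^ 2 ∸ q) (q ∸ 1) (q ^ 2 ∸ q ∸ 1) (C₂-bound-defined 3≤q) ∸ (q ^ 2 + q ∸ 3)
      ≡⟨ cong₂ _∸_ (upperBound-value a (C₂-bound-defined 3≤q) refl (sym (points≡ q)) refl) n≡ ⟩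
    (2 + a) * (5 + a) ∸ (q * q + a)
      ≡⟨ cong (_∸ (q * q + a)) (eq a) ⟩
    1 + (q * q + a) ∸ (q * q + a)
      ≡⟨ m+n∸n≡m 1 (q * q + a) ⟩
    1 ∎)
  where
  open ≡-Reasoning
  q = 3 + a

  n≡ : q ^ 2 + q ∸ 3 ≡ q * q + a
  n≡ = trans (+-∸-assoc (q ^ 2) {q} 3≤q) (cong (_+ a) (q^2≡q*q q))

  eq : ∀ a → (2 + a) * (5 + a) ≡ 1 + ((3 + a) * (3 + a) + a)
  eq = solve-∀
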